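{- For any graph $G$, any vertex $v\in V(G)$, any integer $k\ge 2$ and any integer $r\ge 3$, $$R_r(\mathcal{B}(G),k)\le R(\mathcal{G}^*(v),k)+r-2.$$
   Context: For a graph $G$, a hypergraph $H$ is a Berge-$G$ hypergraph if there are an injective map $\phi:V(G)\to V(H)$ and pairwise distinct hyperedges $e_{xy}\in E(H)$, one for each $xy\in E(G)$, with $\phi(x),\phi(y)\in e_{xy}$. $\mathcal{B}(G)$ denotes the family of all Berge-$G$ hypergraphs. $K_n^r$ denotes the complete $r$-uniform hypergraph on $n$ vertices. For a family $\mathcal{H}$ of $r$-uniform hypergraphs and integers $k\ge 2$, $r\ge 2$, $R_r(\mathcal{H},k)$ is the smallest $n$ such that every $k$-coloring of the hyperedges of $K_n^r$ contains a monochromatic subhypergraph belonging to $\mathcal{H}$. For a family $\mathcal{G}$ of graphs, $R(\mathcal{G},k)$ is the smallest $n$ such that every $k$-coloring of the edges of the complete graph $K_n$ contains a monochromatic subgraph isomorphic to some member of $\mathcal{G}$. For a graph $G$ and $v\in V(G)$ with neighborhood $N(v)=\{q_1,\dots,q_t\}$, let $G'=G-v$. An extension of $G-v$ is any graph obtained from $G'$ by adding, for each $i=1,\dots,t$, an edge $q_ir_i$ not belonging to $G'$, where each $r_i$ is either a vertex of $G'$ or a new vertex not in $G'$ (new vertices may be shared by several $r_i$), and the $t$ added edges are pairwise distinct. $\mathcal{G}^*(v)$ denotes the family of all such extensions (it contains $G$ itself). -}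

module Defs where

open import Data.Bool using (Bool; false; T)
open import Data.Fin using (Fin; punchIn)
open import Data.Fin.Subset using (Subset; _∈_; _⊆_; ∣_∣)
open import Data.Nat using (ℕ; suc; _≤_)
open import Data.Product using (_×_; _,_; Σ-syntax; ∃-syntax)
open import Data.Sum using (_⊎_)
open import Function.Bundles using (_⇔_)
open import Function.Definitions using (Injective)
open import Relation.Binary.PropositionalEquality using (_≡_; _≢_; ≢-sym)
open import Relation.Nullary using (¬_)

-- Finite simple graphs on the vertex set Fin n.
record Graph (n : ℕ) : Set where
  field
    adj       : Fin n → Fin n → Bool
    symmetric : ∀ x y → adj x y ≡ adj y x
    loopless  : ∀ x → adj x x ≡ false

  Adj : Fin n → Fin n → Set
  Adj x y = T (adj x y)

open Graph public using (Adj)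

infix 4 _≐_

-- Equality of the unordered pairs {x , y} and {x′ , y′}.
_≐_ : ∀ {n} → Fin n × Fin n → Fin n × Fin n → Set
(x , y) ≐ (x′ , y′) = (x ≡ x′ × y ≡ y′) ⊎ (x ≡ y′ × y ≡ x′)

infixl 6 _-ᵛ_

-- The vertices of G - v are renumbered by Fin n along punchIn v, the
-- order-preserving bijection from Fin n onto Fin (suc n) ∖ {v}.
_-ᵛ_ : ∀ {n} → Graph (suc n) → Fin (suc n) → Graph n
G -ᵛ v = record
  { adj       = λ x y → G.adj (punchIn v x) (punchIn v y)
  ; symmetric = λ x y → G.symmetric (punchIn v x) (punchIn v y)
  ; loopless  = λ x → G.loopless (punchIn v x)
  }
  where module G = Graph G

-- The neighbourhood of v, as a set of vertices of G - v.
Neighbour : ∀ {n} → Graph (suc n) → Fin (suc n) → Fin n → Set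
Neighbour G v q = Adj G v (punchIn v q)

-- F is an extension of G - v: ι places the vertices of G - v in F, the
-- vertices of F outside the image of ι are the new ones, and end q _ is the
-- second endpoint rᵢ of the edge added at the neighbour q = qᵢ of v.
-- That rᵢ ≠ qᵢ follows from edges, since F has no loops.
record Extension {n m} (G : Graph (suc n)) (v : Fin (suc n)) (F : Graph m) : Set where
  field
    ι           : Fin n → Fin m
    ι-injective : Injective _≡_ _≡_ ι
    end         : ∀ q → Neighbour G v q → Fin m

  OldEdge : Fin m → Fin m → Set
  OldEdge a b = ∃[ x ] ∃[ y ] (Adj (G -ᵛ v) x y × a ≡ ι x × b ≡ ι y)

  AddedEdge : Fin m → Fin m → Set
  AddedEdge a b = ∃[ q ] Σ[ p ∈ Neighbour G v q ] (a , b) ≐ (ι q , end q p)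

  field
    vertices : ∀ a → (∃[ x ] a ≡ ι x) ⊎ (∃[ q ] Σ[ p ∈ Neighbour G v q ] a ≡ end q p)
    edges    : ∀ a b → Adj F a b ⇔ (OldEdge a b ⊎ AddedEdge a b)
    notOld   : ∀ q (p : Neighbour G v q) → ¬ OldEdge (ι q) (end q p)
    distinct : ∀ q q′ (p : Neighbour G v q) (p′ : Neighbour G v q′) →
               (ι q , end q p) ≐ (ι q′ , end q′ p′) → q ≡ q′

GraphFamily : Set₁
GraphFamily = ∀ {m} → Graph m → Set

𝒢* : ∀ {n} → Graph (suc n) → Fin (suc n) → GraphFamily
𝒢* G v F = Extension G v F

-- Hypergraphs whose vertex set is a subset of Fin n; thus a subhypergraph of
-- a hypergraph on Fin n is again a Hypergraph n.
record Hypergraph (n : ℕ) : Set where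
  field
    V     : Subset n
    edge  : Subset n → Bool
    edge⊆ : ∀ e → T (edge e) → e ⊆ V

  Hyperedge : Subset n → Set
  Hyperedge e = T (edge e)

open Hypergraph public using (V; Hyperedge)

HypergraphFamily : Set₁
HypergraphFamily = ∀ {n} → Hypergraph n → Set

-- hyperedge-≐ says both that the chosen hyperedge depends only on the
-- unordered edge xy and that distinct edges get distinct hyperedges.
record Berge {g n} (G : Graph g) (H : Hypergraph n) : Set where
  field
    φ           : Fin g → Fin n
    φ-injective : Injective _≡_ _≡_ φ
    φ∈V         : ∀ x → φ x ∈ V H
    hyperedge   : ∀ x y → Adj G x y → Subset n
    hyperedge∈H : ∀ x y p → Hyperedge H (hyperedge x y p)
    ends∈       : ∀ x y p → φ x ∈ hyperedge x y p × φ y ∈ hyperedge x y p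
    hyperedge-≐ : ∀ x y x′ y′ p p′ →
                  hyperedge x y p ≡ hyperedge x′ y′ p′ ⇔ (x , y) ≐ (x′ , y′)

𝓑 : ∀ {g} → Graph g → HypergraphFamily
𝓑 G H = Berge G H

-- Colourings with k colours of the edges of the complete graph on Fin n.
record EdgeColouring (n k : ℕ) : Set where
  field
    colour    : (x y : Fin n) → x ≢ y → Fin k
    symmetric : ∀ x y (x≢y : x ≢ y) → colour x y x≢y ≡ colour y x (≢-sym x≢y)

open EdgeColouring public using (colour)

-- An isomorphic copy of F all of whose edges have colour i.
record MonoCopy {n k m} (c : EdgeColouring n k) (i : Fin k) (F : Graph m) : Set where
  field
    f           : Fin m → Fin n
    f-injective : Injective _≡_ _≡_ f
    mono        : ∀ x y → Adj F x y →
                  Σ[ fx≢fy ∈ f x ≢ f y ] colour c (f x) (f y) fx≢fy ≡ i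

-- Colourings with k colours of the hyperedges of K_n^r, the r-subsets of Fin n.
HyperColouring : ℕ → ℕ → ℕ → Set
HyperColouring n r k = (e : Subset n) → ∣ e ∣ ≡ r → Fin k

-- H is a subhypergraph of K_n^r all of whose hyperedges have colour i.
MonoSub : ∀ {n r k} → HyperColouring n r k → Fin k → Hypergraph n → Set
MonoSub {r = r} c i H = ∀ e → Hyperedge H e → Σ[ p ∈ ∣ e ∣ ≡ r ] c e p ≡ i

RamseyProperty : GraphFamily → ℕ → ℕ → Set
RamseyProperty 𝓕 k n =
  (c : EdgeColouring n k) →
  ∃[ i ] ∃[ m ] Σ[ F ∈ Graph m ] (𝓕 F × MonoCopy c i F)

HyperRamseyProperty : ℕ → HypergraphFamily → ℕ → ℕ → Set
HyperRamseyProperty r 𝓗 k n =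
  (c : HyperColouring n r k) →
  ∃[ i ] Σ[ H ∈ Hypergraph n ] (𝓗 H × MonoSub c i H)

IsLeast : (ℕ → Set) → ℕ → Set
IsLeast P n = P n × (∀ m → P m → n ≤ m)

-- R(𝓕 , k) = n
IsRamseyNumber : GraphFamily → ℕ → ℕ → Set
IsRamseyNumber 𝓕 k = IsLeast (RamseyProperty 𝓕 k)

-- R_r(𝓗 , k) = n
IsHyperRamseyNumber : ℕ → HypergraphFamily → ℕ → ℕ → Set
IsHyperRamseyNumber r 𝓗 k = IsLeast (HyperRamseyProperty r 𝓗 k)

{-# OPTIONS --safe #-}

-- Fix a set of r - 2 vertices, the core, and colour the pair xy of remaining
-- vertices with the colour of the r-set core ∪ {x , y}. In a monochromatic
-- extension F of G - v, enlarging each edge by the core gives a Berge-G: since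
-- r ≥ 3 there is a core vertex to which v can be sent, it lies in all these
-- r-sets, and so it does not matter where the edge added at qᵢ ends.
-- That a least M exists at all, constructively, is because the hypergraph Ramsey
-- property is decidable by exhaustive search.
module Submission where

open import Defs
open import Data.Nat using (ℕ; zero; suc; _≤_; z≤n; s≤s; _+_; _∸_)
open import Data.Nat.Properties using (+-comm; ≡-irrelevant) renaming (_≟_ to _≟ℕ_)
open import Data.Fin using (Fin; zero; suc; punchIn; punchOut; _↑ʳ_; _≟_)
open import Data.Fin.Properties
  using (any?; all?; punchIn-injective; punchInᵢ≢i; punchIn-punchOut; ↑ʳ-injective)
open import Data.Fin.Subset
  using (Subset; inside; outside; _∈_; _⊆_; ∣_∣; ⊤; ⁅_⁆; _∪_)
open import Data.Fin.Subset.Properties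
  using (∈⊤; _∈?_; x∈⁅x⁆; x∈⁅y⁆⇒x≡y; x∈p∪q⁻; x∈p∪q⁺;
         ∪-comm; ∪-identityˡ; ∪-identityʳ; ∣⁅x⁆∣≡1)
open import Data.Bool using (true; false; T)
import Data.Bool.Properties as Bool
open import Data.List using (List; []; _∷_; map; allFin; cartesianProductWith)
import Data.List.Relation.Unary.All as All
open import Data.List.Relation.Unary.Any as Any using (Any; here; there)
import Data.List.Relation.Unary.Any.Properties as Any
open import Data.List.Membership.Propositional.Properties using (∈-allFin)
open import Data.Product using (_×_; _,_; proj₁; proj₂; ∃; ∃-syntax; Σ-syntax)
open import Data.Sum using (_⊎_; inj₁; inj₂)
open import Data.Unit using (tt)
open import Data.Vec using ([]; _∷_; _++_; here; there)
open import Data.Vec.Functional using (insertAt)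
open import Data.Vec.Functional.Properties using (insertAt-lookup; insertAt-punchIn)
open import Data.Vec.Properties using (≡-dec; ++-injectiveʳ)
open import Function using (_∘_; const)
open import Function.Bundles using (mk⇔; module Equivalence)
open import Function.Definitions using (Injective)
open import Relation.Binary.PropositionalEquality
  using (_≡_; _≢_; refl; sym; trans; cong; cong₂; subst; subst₂)
open import Relation.Nullary using (¬_; Dec; yes; no; Irrelevant; contradiction)
open import Relation.Nullary.Decidable
  using (map′; T?; ⌊_⌋; fromWitness; toWitness; _×-dec_; _⊎-dec_; _→-dec_)
open import Relation.Unary using (Decidable)

-- Exhaustive search

-- Finiteness up to _≈_: without function extensionality, function types are
-- finite only up to pointwise equality.
Finite : {A : Set} → (A → A → Set) → Set
Finite {A} _≈_ = Σ[ xs ∈ List A ] (∀ a → Any (a ≈_) xs)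

module _ {A : Set} {_≈_ : A → A → Set} {P : A → Set} (fin : Finite _≈_) where

  -- A witness need not be listed itself, only something `≈` to it. Hence `resp` carries `P` from a
  -- witness to its listed representative; in `finite-∀?` it goes the other way, from the
  -- representative back to an arbitrary element.
  finite-∃? : (∀ {a b} → a ≈ b → P a → P b) → Decidable P → Dec (∃ P)
  finite-∃? resp P? =
    map′ Any.satisfied
         (λ (a , Pa) → Any.map (λ a≈b → resp a≈b Pa) (proj₂ fin a))
         (Any.any? P? (proj₁ fin))

  finite-∀? : (∀ {a b} → a ≈ b → P b → P a) → Decidable P → Dec (∀ a → P a)
  finite-∀? resp P? =
    map′ (λ Ps a → All.lookupWith {R = λ _ → P a} (λ Pb a≈b → resp a≈b Pb) Ps (proj₂ fin a))
         (λ P∀ → All.universal P∀ (proj₁ fin))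
         (All.all? P? (proj₁ fin))

Fin-finite : ∀ n → Finite {Fin n} _≡_
Fin-finite n = allFin n , ∈-allFin

Subset-finite : ∀ n → Finite {Subset n} _≡_
Subset-finite zero    = ([] ∷ []) , λ { [] → here refl }
Subset-finite (suc n) =
  cartesianProductWith _∷_ (inside ∷ outside ∷ []) (proj₁ (Subset-finite n)) ,
  λ { (s ∷ p) → Any.cartesianProductWith⁺ _∷_ (cong₂ _∷_) (sides s) (proj₂ (Subset-finite n) p) }
  where
  sides : ∀ s → Any (s ≡_) (inside ∷ outside ∷ [])
  sides true  = here refl
  sides false = there (here refl)

-- A function on a proposition is fixed by one value if `P` holds, and all functions agree vacuously
-- if it fails. This covers arguments that are proofs, such as adjacency of `x` and `y` or
-- `∣ e ∣ ≡ r`.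
Π-prop-finite : ∀ {P A : Set} {_≈_ : A → A → Set} → Dec P → Irrelevant P → Finite _≈_ →
                Finite {P → A} (λ f g → ∀ p → f p ≈ g p)
Π-prop-finite {_≈_ = _≈_} (yes p) irr (xs , cover) =
  map const xs ,
  λ f → Any.map⁺ (Any.map (λ {x} fp≈x q → subst (λ q → f q ≈ x) (irr p q) fp≈x) (cover (f p)))
Π-prop-finite (no ¬p) irr _ =
  ((λ p → contradiction p ¬p) ∷ []) , λ f → here λ p → contradiction p ¬p

Π-Fin-finite : ∀ {n} {B : Fin n → Set} {_≈_ : ∀ {i} → B i → B i → Set} →
               (∀ i → Finite (_≈_ {i})) →
               Finite {∀ i → B i} (λ f g → ∀ i → f i ≈ g i)
Π-Fin-finite {zero}          fin = ((λ ()) ∷ []) , λ _ → here λ ()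
Π-Fin-finite {suc n} {B} {_≈_} fin =
  cartesianProductWith cons (proj₁ (fin zero)) (proj₁ rest) ,
  λ f → Any.cartesianProductWith⁺ cons cons-≈ (proj₂ (fin zero) (f zero)) (proj₂ rest (f ∘ suc))
  where
  rest = Π-Fin-finite {n} {B ∘ suc} {_≈_} (fin ∘ suc)

  cons : B zero → (∀ i → B (suc i)) → ∀ i → B i
  cons b g zero    = b
  cons b g (suc i) = g i

  cons-≈ : ∀ {f : ∀ i → B i} {b g} → f zero ≈ b → (∀ i → f (suc i) ≈ g i) →
           ∀ i → f i ≈ cons b g i
  cons-≈ f≈b f≈g zero    = f≈b
  cons-≈ f≈b f≈g (suc i) = f≈g i

-- Splitting the subsets by whether they contain the first vertex turns a function on them into a
-- pair of functions on smaller subsets. Colourings of r-sets are functions of this kind.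
Π-Subset-finite : ∀ {n} {B : Subset n → Set} {_≈_ : ∀ {e} → B e → B e → Set} →
                  (∀ e → Finite (_≈_ {e})) →
                  Finite {∀ e → B e} (λ f g → ∀ e → f e ≈ g e)
Π-Subset-finite {zero} fin =
  map (λ { b [] → b }) (proj₁ (fin [])) ,
  λ f → Any.map⁺ (Any.map (λ { f≈b [] → f≈b }) (proj₂ (fin []) (f [])))
Π-Subset-finite {suc n} {B} {_≈_} fin =
  cartesianProductWith glue (proj₁ (half inside)) (proj₁ (half outside)) ,
  λ f → Any.cartesianProductWith⁺ glue glue-≈
          (proj₂ (half inside)  (f ∘ (inside ∷_)))
          (proj₂ (half outside) (f ∘ (outside ∷_)))
  where
  half = λ s → Π-Subset-finite {n} {B ∘ (s ∷_)} {_≈_} (fin ∘ (s ∷_))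

  glue : (∀ e → B (inside ∷ e)) → (∀ e → B (outside ∷ e)) → ∀ e → B e
  glue g h (true  ∷ e) = g e
  glue g h (false ∷ e) = h e

  glue-≈ : ∀ {f : ∀ e → B e} {g h} →
           (∀ e → f (inside ∷ e) ≈ g e) → (∀ e → f (outside ∷ e) ≈ h e) →
           ∀ e → f e ≈ glue g h e
  glue-≈ f≈g f≈h (true  ∷ e) = f≈g e
  glue-≈ f≈g f≈h (false ∷ e) = f≈h e

∀T? : ∀ {b} {P : T b → Set} → Decidable P → Dec (∀ p → P p)
∀T? {true}  P? = map′ (λ Ptt _ → Ptt) (λ P∀ → P∀ tt) (P? tt)
∀T? {false} P? = yes λ ()

-- If `P` fails at zero, the least witness of `P ∘ suc`, shifted by one, is least for `P`; the known
-- witness `n` bounds the search.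
least : ∀ {P : ℕ → Set} → Decidable P → ∀ n → P n → ∃[ m ] (IsLeast P m × m ≤ n)
least P? n Pn with P? zero
least P? n       Pn | yes P0 = zero , (P0 , λ _ _ → z≤n) , z≤n
least P? zero    P0 | no ¬P0 = contradiction P0 ¬P0
least {P} P? (suc n) Pn | no ¬P0 with least (P? ∘ suc) n Pn
... | m , (Pm , m-least) , m≤n = suc m , (Pm , bound) , s≤s m≤n
  where
  bound : ∀ j → P j → suc m ≤ j
  bound zero    P0 = contradiction P0 ¬P0
  bound (suc j) Pj = s≤s (m-least j Pj)

-- Unordered pairs

≐-sym : ∀ {n} {p q : Fin n × Fin n} → p ≐ q → q ≐ p
≐-sym (inj₁ (refl , refl)) = inj₁ (refl , refl)
≐-sym (inj₂ (refl , refl)) = inj₂ (refl , refl)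

≐-trans : ∀ {n} {p q s : Fin n × Fin n} → p ≐ q → q ≐ s → p ≐ s
≐-trans (inj₁ (refl , refl)) q≐s                  = q≐s
≐-trans (inj₂ (refl , refl)) (inj₁ (refl , refl)) = inj₂ (refl , refl)
≐-trans (inj₂ (refl , refl)) (inj₂ (refl , refl)) = inj₁ (refl , refl)

≐-injective : ∀ {m n} {f : Fin m → Fin n} → Injective _≡_ _≡_ f →
              ∀ {a b a′ b′} → (f a , f b) ≐ (f a′ , f b′) → (a , b) ≐ (a′ , b′)
≐-injective inj (inj₁ (p , q)) = inj₁ (inj p , inj q)
≐-injective inj (inj₂ (p , q)) = inj₂ (inj p , inj q)

_≐?_ : ∀ {n} (p q : Fin n × Fin n) → Dec (p ≐ q)
(x , y) ≐? (x′ , y′) = (x ≟ x′ ×-dec y ≟ y′) ⊎-dec (x ≟ y′ ×-dec y ≟ x′)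

-- Deciding the hypergraph Ramsey property

_≟ˢ_ : ∀ {n} (e e′ : Subset n) → Dec (e ≡ e′)
_≟ˢ_ = ≡-dec Bool._≟_

module _ {g n} (G : Graph g) (H : Hypergraph n) where

  -- `Berge` with its data as parameters: for fixed `φ` and `h` each condition is a finite
  -- conjunction of decidable statements, so that only `φ` and `h` remain to be searched for.
  IsBerge : (Fin g → Fin n) → (∀ x y → Adj G x y → Subset n) → Set
  IsBerge φ h =
    (∀ x y → φ x ≡ φ y → x ≡ y) ×
    (∀ x → φ x ∈ V H) ×
    (∀ x y p → Hyperedge H (h x y p)) ×
    (∀ x y p → φ x ∈ h x y p × φ y ∈ h x y p) ×
    (∀ x y x′ y′ p p′ → (h x y p ≡ h x′ y′ p′ → (x , y) ≐ (x′ , y′)) ×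
                        ((x , y) ≐ (x′ , y′) → h x y p ≡ h x′ y′ p′))

  isBerge? : ∀ φ h → Dec (IsBerge φ h)
  isBerge? φ h =
    (all? λ x → all? λ y → φ x ≟ φ y →-dec x ≟ y) ×-dec
    (all? λ x → φ x ∈? V H) ×-dec
    (all? λ x → all? λ y → ∀T? λ p → T? _) ×-dec
    (all? λ x → all? λ y → ∀T? λ p → φ x ∈? h x y p ×-dec φ y ∈? h x y p) ×-dec
    (all? λ x → all? λ y → all? λ x′ → all? λ y′ → ∀T? λ p → ∀T? λ p′ →
       (h x y p ≟ˢ h x′ y′ p′ →-dec (x , y) ≐? (x′ , y′)) ×-dec
       ((x , y) ≐? (x′ , y′) →-dec h x y p ≟ˢ h x′ y′ p′))

  isBerge-respˡ : ∀ {φ φ′ h} → (∀ x → φ x ≡ φ′ x) → IsBerge φ h → IsBerge φ′ h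
  isBerge-respˡ φ≗φ′ (inj , inV , inH , ends , iff) =
    (λ x y eq → inj x y (trans (φ≗φ′ x) (trans eq (sym (φ≗φ′ y))))) ,
    (λ x → subst (_∈ V H) (φ≗φ′ x) (inV x)) ,
    inH ,
    (λ x y p → subst (_∈ _) (φ≗φ′ x) (proj₁ (ends x y p)) ,
               subst (_∈ _) (φ≗φ′ y) (proj₂ (ends x y p))) ,
    iff

  isBerge-respʳ : ∀ {φ h h′} → (∀ x y p → h x y p ≡ h′ x y p) → IsBerge φ h → IsBerge φ h′
  isBerge-respʳ {φ} h≗h′ (inj , inV , inH , ends , iff) =
    inj ,
    inV ,
    (λ x y p → subst (Hyperedge H) (h≗h′ x y p) (inH x y p)) ,
    (λ x y p → subst (λ e → φ x ∈ e × φ y ∈ e) (h≗h′ x y p) (ends x y p)) ,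
    (λ x y x′ y′ p p′ → subst₂ (λ e e′ → (e ≡ e′ → (x , y) ≐ (x′ , y′)) ×
                                         ((x , y) ≐ (x′ , y′) → e ≡ e′))
                          (h≗h′ x y p) (h≗h′ x′ y′ p′) (iff x y x′ y′ p p′))

  berge? : Dec (Berge G H)
  berge? =
    map′ to from
      (finite-∃? (Π-Fin-finite λ _ → Fin-finite n)
        (λ φ≗φ′ (h , b) → h , isBerge-respˡ φ≗φ′ b)
        (λ φ → finite-∃?
          (Π-Fin-finite λ x → Π-Fin-finite λ y →
             Π-prop-finite (T? _) Bool.T-irrelevant (Subset-finite n))
          isBerge-respʳ (isBerge? φ)))
    where
    to : ∃ (λ φ → ∃ (IsBerge φ)) → Berge G H
    to (φ , h , inj , inV , inH , ends , iff) = record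
      { φ           = φ
      ; φ-injective = inj _ _
      ; φ∈V         = inV
      ; hyperedge   = h
      ; hyperedge∈H = inH
      ; ends∈       = ends
      ; hyperedge-≐ = λ x y x′ y′ p p′ →
          mk⇔ (proj₁ (iff x y x′ y′ p p′)) (proj₂ (iff x y x′ y′ p p′))
      }

    from : Berge G H → ∃ (λ φ → ∃ (IsBerge φ))
    from b = φ , hyperedge , (λ _ _ → φ-injective) , φ∈V , hyperedge∈H , ends∈ ,
      λ x y x′ y′ p p′ → Equivalence.to (hyperedge-≐ x y x′ y′ p p′) ,
                         Equivalence.from (hyperedge-≐ x y x′ y′ p p′)
      where open Berge b

-- The vertices and hyperedges of `H` occur only positively in the definition of a Berge hypergraph,
-- so the same data serve in any larger one.
Berge-⊆ : ∀ {g n} {G : Graph g} {H H′ : Hypergraph n} → V H ⊆ V H′ →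
          (∀ e → Hyperedge H e → Hyperedge H′ e) → Berge G H → Berge G H′
Berge-⊆ V⊆ E⊆ b = record
  { φ           = φ
  ; φ-injective = φ-injective
  ; φ∈V         = λ x → V⊆ (φ∈V x)
  ; hyperedge   = hyperedge
  ; hyperedge∈H = λ x y p → E⊆ _ (hyperedge∈H x y p)
  ; ends∈       = ends∈
  ; hyperedge-≐ = hyperedge-≐
  }
  where open Berge b

module _ {n r k} (c : HyperColouring n r k) (i : Fin k) where

  HasColour : Subset n → Set
  HasColour e = Σ[ p ∈ ∣ e ∣ ≡ r ] c e p ≡ i

  hasColour? : Decidable HasColour
  hasColour? e with ∣ e ∣ ≟ℕ r
  ... | no  ∣e∣≢r = no (∣e∣≢r ∘ proj₁)
  ... | yes ∣e∣≡r =
    -- The colour formally depends on the size proof; irrelevance of equality on ℕ moves it to the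
    -- proof at hand.
    map′ (∣e∣≡r ,_) (λ (p , eq) → subst (λ p → c e p ≡ i) (≡-irrelevant p ∣e∣≡r) eq)
         (c e ∣e∣≡r ≟ i)

  -- The largest monochromatic hypergraph of colour `i`. By `Berge-⊆` it contains a Berge-G as soon
  -- as any monochromatic one of that colour does, so a single hypergraph per colour has to be
  -- tested.
  colourClass : Hypergraph n
  colourClass = record
    { V     = ⊤
    ; edge  = λ e → ⌊ hasColour? e ⌋
    ; edge⊆ = λ _ _ _ → ∈⊤
    }

  colourClass-mono : MonoSub c i colourClass
  colourClass-mono e = toWitness

  monoSub⊆colourClass : ∀ {H} → MonoSub c i H → ∀ e → Hyperedge H e → Hyperedge colourClass e
  monoSub⊆colourClass mono e e∈H = fromWitness (mono e e∈H)

hyperRamsey? : ∀ {g} (G : Graph g) r k → Decidable (HyperRamseyProperty r (𝓑 G) k)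
hyperRamsey? G r k n =
  map′ to from
    (finite-∀? (Π-Subset-finite λ e → Π-prop-finite (∣ e ∣ ≟ℕ r) ≡-irrelevant (Fin-finite k))
      monoBerge-resp (λ c → any? λ i → berge? G (colourClass c i)))
  where
  MonoBerge : HyperColouring n r k → Set
  MonoBerge c = ∃[ i ] Berge G (colourClass c i)

  monoBerge-resp : ∀ {c c′} → (∀ e p → c e p ≡ c′ e p) → MonoBerge c′ → MonoBerge c
  monoBerge-resp {c} {c′} c≗c′ (i , b) = i , Berge-⊆ (λ x∈ → x∈) class⊆ b
    where
    class⊆ : ∀ e → Hyperedge (colourClass c′ i) e → Hyperedge (colourClass c i) e
    class⊆ e e∈ = let p , eq = colourClass-mono c′ i e e∈ in fromWitness (p , trans (c≗c′ e p) eq)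

  to : (∀ c → MonoBerge c) → HyperRamseyProperty r (𝓑 G) k n
  to P c = let i , b = P c in i , colourClass c i , b , colourClass-mono c i

  from : HyperRamseyProperty r (𝓑 G) k n → ∀ c → MonoBerge c
  from P c = let i , H , b , mono = P c in
    i , Berge-⊆ (λ _ → ∈⊤) (monoSub⊆colourClass c i {H} mono) b

-- Pairs enlarged by the core

module _ (t : ℕ) {N : ℕ} where

  -- The core is the first `t` vertices of `Fin (t + N)`; the others are the image of `t ↑ʳ_`. With
  -- `t = r - 2` these sets have size `r` when `x ≢ y`.
  core∪ : Fin N → Fin N → Subset (t + N)
  core∪ x y = ⊤ {t} ++ (⁅ x ⁆ ∪ ⁅ y ⁆)

  core∪-comm : ∀ x y → core∪ x y ≡ core∪ y x
  core∪-comm x y = cong (⊤ {t} ++_) (∪-comm ⁅ x ⁆ ⁅ y ⁆)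

∣⊤++p∣ : ∀ t {N} (p : Subset N) → ∣ ⊤ {t} ++ p ∣ ≡ t + ∣ p ∣
∣⊤++p∣ zero    p = refl
∣⊤++p∣ (suc t) p = cong suc (∣⊤++p∣ t p)

↑ʳ∈⊤++p : ∀ t {N} {p : Subset N} {x} → x ∈ p → t ↑ʳ x ∈ ⊤ {t} ++ p
↑ʳ∈⊤++p zero    x∈p = x∈p
↑ʳ∈⊤++p (suc t) x∈p = there (↑ʳ∈⊤++p t x∈p)

∣⁅x⁆∪⁅y⁆∣≡2 : ∀ {N} {x y : Fin N} → x ≢ y → ∣ ⁅ x ⁆ ∪ ⁅ y ⁆ ∣ ≡ 2
∣⁅x⁆∪⁅y⁆∣≡2 {x = zero}  {zero}  0≢0 = contradiction refl 0≢0
∣⁅x⁆∪⁅y⁆∣≡2 {x = zero}  {suc y} _   =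
  cong suc (trans (cong ∣_∣ (∪-identityˡ ⁅ y ⁆)) (∣⁅x⁆∣≡1 y))
∣⁅x⁆∪⁅y⁆∣≡2 {x = suc x} {zero}  _   =
  cong suc (trans (cong ∣_∣ (∪-identityʳ ⁅ x ⁆)) (∣⁅x⁆∣≡1 x))
∣⁅x⁆∪⁅y⁆∣≡2 {x = suc x} {suc y} x≢y = ∣⁅x⁆∪⁅y⁆∣≡2 (x≢y ∘ cong suc)

∣core∪∣ : ∀ t {N} {x y : Fin N} → x ≢ y → ∣ core∪ t x y ∣ ≡ 2 + t
∣core∪∣ t {x = x} {y} x≢y =
  trans (∣⊤++p∣ t (⁅ x ⁆ ∪ ⁅ y ⁆)) (trans (cong (t +_) (∣⁅x⁆∪⁅y⁆∣≡2 x≢y)) (+-comm t 2))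

∈⁅x⁆∪⁅y⁆⁻ : ∀ {N} {x y z : Fin N} → z ∈ ⁅ x ⁆ ∪ ⁅ y ⁆ → z ≡ x ⊎ z ≡ y
∈⁅x⁆∪⁅y⁆⁻ {x = x} {y} z∈ with x∈p∪q⁻ ⁅ x ⁆ ⁅ y ⁆ z∈
... | inj₁ z∈x = inj₁ (x∈⁅y⁆⇒x≡y x z∈x)
... | inj₂ z∈y = inj₂ (x∈⁅y⁆⇒x≡y y z∈y)

x∈⁅x⁆∪⁅y⁆ : ∀ {N} (x y : Fin N) → x ∈ ⁅ x ⁆ ∪ ⁅ y ⁆
x∈⁅x⁆∪⁅y⁆ x y = x∈p∪q⁺ (inj₁ (x∈⁅x⁆ x))

y∈⁅x⁆∪⁅y⁆ : ∀ {N} (x y : Fin N) → y ∈ ⁅ x ⁆ ∪ ⁅ y ⁆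
y∈⁅x⁆∪⁅y⁆ x y = x∈p∪q⁺ {p = ⁅ x ⁆} (inj₂ (x∈⁅x⁆ y))

⁅x⁆∪⁅y⁆-injective : ∀ {N} {x y x′ y′ : Fin N} →
                    ⁅ x ⁆ ∪ ⁅ y ⁆ ≡ ⁅ x′ ⁆ ∪ ⁅ y′ ⁆ → (x , y) ≐ (x′ , y′)
⁅x⁆∪⁅y⁆-injective {x = x} {y} {x′} {y′} eq
  with ∈⁅x⁆∪⁅y⁆⁻ (subst (x ∈_) eq (x∈⁅x⁆∪⁅y⁆ x y))
     | ∈⁅x⁆∪⁅y⁆⁻ (subst (y ∈_) eq (y∈⁅x⁆∪⁅y⁆ x y))
     | ∈⁅x⁆∪⁅y⁆⁻ (subst (x′ ∈_) (sym eq) (x∈⁅x⁆∪⁅y⁆ x′ y′))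
     | ∈⁅x⁆∪⁅y⁆⁻ (subst (y′ ∈_) (sym eq) (y∈⁅x⁆∪⁅y⁆ x′ y′))
... | inj₁ x≡x′ | inj₂ y≡y′ | _         | _         = inj₁ (x≡x′ , y≡y′)
... | inj₂ x≡y′ | inj₁ y≡x′ | _         | _         = inj₂ (x≡y′ , y≡x′)
-- If `x` and `y` both equal the same end of the other pair, the other end, being `x` or `y` in
-- turn, supplies the missing equality.
... | inj₁ x≡x′ | inj₁ y≡x′ | _         | inj₁ y′≡x = inj₂ (sym y′≡x , y≡x′)
... | inj₁ x≡x′ | inj₁ y≡x′ | _         | inj₂ y′≡y = inj₁ (x≡x′ , sym y′≡y)
... | inj₂ x≡y′ | inj₂ y≡y′ | inj₁ x′≡x | _         = inj₁ (sym x′≡x , y≡y′)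
... | inj₂ x≡y′ | inj₂ y≡y′ | inj₂ x′≡y | _         = inj₂ (x≡y′ , sym x′≡y)

core∪-injective : ∀ t {N} {x y x′ y′ : Fin N} →
                  core∪ t x y ≡ core∪ t x′ y′ → (x , y) ≐ (x′ , y′)
core∪-injective t eq = ⁅x⁆∪⁅y⁆-injective (++-injectiveʳ (⊤ {t}) ⊤ eq)

hyperColour-cong : ∀ {n r k} (c : HyperColouring n r k) {e e′} → e ≡ e′ →
                   ∀ p p′ → c e p ≡ c e′ p′
hyperColour-cong c refl p p′ = cong (c _) (≡-irrelevant p p′)

inducedColouring : ∀ t {N k} → HyperColouring (t + N) (2 + t) k → EdgeColouring N k
inducedColouring t c = record
  { colour    = λ x y x≢y → c (core∪ t x y) (∣core∪∣ t x≢y)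
  ; symmetric = λ x y x≢y → hyperColour-cong c (core∪-comm t x y) _ _
  }

-- The edges of G seen in an extension of G - v

punchIn-view : ∀ {n} (v x : Fin (suc n)) → x ≡ v ⊎ ∃[ q ] x ≡ punchIn v q
punchIn-view v x with v ≟ x
... | yes v≡x = inj₁ (sym v≡x)
... | no  v≢x = inj₂ (punchOut v≢x , sym (punchIn-punchOut v≢x))

insertAt-injective : ∀ {A : Set} {n} {f : Fin n → A} {a} v → Injective _≡_ _≡_ f →
                     (∀ q → f q ≢ a) → Injective _≡_ _≡_ (insertAt f v a)
insertAt-injective {f = f} {a} v inj f≢a {x} {y} eq with punchIn-view v x | punchIn-view v y
... | inj₁ refl       | inj₁ refl       = refl
... | inj₁ refl       | inj₂ (q , refl) =
  contradiction (trans (sym (insertAt-punchIn f v a q)) (trans (sym eq) (insertAt-lookup f v a))) (f≢a q)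
... | inj₂ (q , refl) | inj₁ refl       =
  contradiction (trans (sym (insertAt-punchIn f v a q)) (trans eq (insertAt-lookup f v a))) (f≢a q)
... | inj₂ (q , refl) | inj₂ (s , refl) =
  cong (punchIn v)
    (inj (trans (sym (insertAt-punchIn f v a q)) (trans eq (insertAt-punchIn f v a s))))

module _ {n} (G : Graph (suc n)) (v : Fin (suc n)) where

  -- Common names for the edges of `G`, read in `G` through `ends` and in `F` through `image`. An
  -- old edge has a name for each orientation, so readings are compared up to `≐`.
  data Edge : Set where
    old   : ∀ x y → Adj (G -ᵛ v) x y → Edge
    added : ∀ q → Neighbour G v q → Edge

  ends : Edge → Fin (suc n) × Fin (suc n)
  ends (old x y _) = punchIn v x , punchIn v y
  ends (added q _) = v , punchIn v q

  classify : ∀ x y → Adj G x y → Σ[ e ∈ Edge ] ends e ≐ (x , y)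
  classify x y p with punchIn-view v x | punchIn-view v y
  ... | inj₁ refl       | inj₁ refl       = contradiction p (subst (¬_ ∘ T) (sym (Graph.loopless G v)) λ ())
  ... | inj₁ refl       | inj₂ (q , refl) = added q p , inj₁ (refl , refl)
  ... | inj₂ (q , refl) | inj₁ refl       = added q (subst T (Graph.symmetric G _ _) p) , inj₂ (refl , refl)
  ... | inj₂ (q , refl) | inj₂ (s , refl) = old q s p , inj₁ (refl , refl)

  module _ {m} {F : Graph m} (ext : Extension G v F) where
    open Extension ext

    image : Edge → Fin m × Fin m
    image (old x y _) = ι x , ι y
    image (added q p) = ι q , end q p

    image-adj : ∀ e → Adj F (proj₁ (image e)) (proj₂ (image e))
    image-adj (old x y p) = Equivalence.from (edges _ _) (inj₁ (x , y , p , refl , refl))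
    image-adj (added q p) = Equivalence.from (edges _ _) (inj₂ (q , p , inj₁ (refl , refl)))

    old≐⇒OldEdge : ∀ {x y a b} → Adj (G -ᵛ v) x y → (ι x , ι y) ≐ (a , b) → OldEdge a b
    old≐⇒OldEdge p (inj₁ (refl , refl)) = _ , _ , p , refl , refl
    old≐⇒OldEdge p (inj₂ (refl , refl)) =
      _ , _ , subst T (Graph.symmetric (G -ᵛ v) _ _) p , refl , refl

    -- Two old edges are separated by injectivity of `ι`, an old and an added one by `notOld`, two
    -- added ones by `distinct`. This will make the hyperedges of distinct edges of `G` distinct.
    image-≐⇒ends-≐ : ∀ e e′ → image e ≐ image e′ → ends e ≐ ends e′
    image-≐⇒ends-≐ (old x y p) (old x′ y′ p′) eq with ≐-injective ι-injective eq
    ... | inj₁ (refl , refl) = inj₁ (refl , refl)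
    ... | inj₂ (refl , refl) = inj₂ (refl , refl)
    image-≐⇒ends-≐ (old x y p) (added q p′) eq = contradiction (old≐⇒OldEdge p eq) (notOld q p′)
    image-≐⇒ends-≐ (added q p) (old x y p′) eq = contradiction (old≐⇒OldEdge p′ (≐-sym eq)) (notOld q p)
    image-≐⇒ends-≐ (added q p) (added q′ p′) eq with distinct q q′ p p′ eq
    ... | refl = inj₁ (refl , refl)

    -- Here the mixed cases are impossible because `punchIn v` avoids `v`. This will make the
    -- hyperedge depend on the unordered edge alone.
    ends-≐⇒image-≐ : ∀ e e′ → ends e ≐ ends e′ → image e ≐ image e′
    ends-≐⇒image-≐ (old x y p) (old x′ y′ p′) eq with ≐-injective (punchIn-injective v _ _) eq
    ... | inj₁ (refl , refl) = inj₁ (refl , refl)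
    ... | inj₂ (refl , refl) = inj₂ (refl , refl)
    ends-≐⇒image-≐ (old x y p) (added q p′) (inj₁ (eq , _)) = contradiction eq (punchInᵢ≢i v x)
    ends-≐⇒image-≐ (old x y p) (added q p′) (inj₂ (_ , eq)) = contradiction eq (punchInᵢ≢i v y)
    ends-≐⇒image-≐ (added q p) (old x y p′) (inj₁ (eq , _)) = contradiction (sym eq) (punchInᵢ≢i v x)
    ends-≐⇒image-≐ (added q p) (old x y p′) (inj₂ (eq , _)) = contradiction (sym eq) (punchInᵢ≢i v y)
    ends-≐⇒image-≐ (added q p) (added q′ p′) (inj₂ (eq , _)) = contradiction (sym eq) (punchInᵢ≢i v q′)
    ends-≐⇒image-≐ (added q p) (added q′ p′) (inj₁ (_ , eq)) with punchIn-injective v q q′ eq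
    -- `end q` also takes the proof of adjacency, and the two proofs must be identified.
    ... | refl = inj₁ (refl , cong (end q) (Bool.T-irrelevant p p′))

-- Berge-G from a monochromatic extension

module _ {n} {G : Graph (suc n)} {v : Fin (suc n)} {m} {F : Graph m} (ext : Extension G v F)
         {s N k} (c : HyperColouring (suc s + N) (3 + s) k) {i : Fin k}
         (copy : MonoCopy (inducedColouring (suc s) c) i F) where
  open Extension ext
  open MonoCopy copy

  private
    t = suc s

    base : Fin n → Fin (t + N)
    base q = t ↑ʳ f (ι q)

    -- As `t = suc s`, the vertex `zero` belongs to the core and can host `v`; the remaining
    -- vertices follow the copy of `F`, outside the core.
    vertex : Fin (suc n) → Fin (t + N)
    vertex = insertAt base v zero

    block : Edge G v → Subset (t + N)
    block e = core∪ t (f (proj₁ (image G v ext e))) (f (proj₂ (image G v ext e)))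

    block-≐ : ∀ {e e′} → image G v ext e ≐ image G v ext e′ → block e ≡ block e′
    block-≐ (inj₁ (p , q)) = cong₂ (λ a b → core∪ t (f a) (f b)) p q
    block-≐ (inj₂ (p , q)) = trans (cong₂ (λ a b → core∪ t (f a) (f b)) p q) (core∪-comm t _ _)

    v∈block : ∀ e → vertex v ∈ block e
    v∈block e = subst (_∈ block e) (sym (insertAt-lookup base v zero)) here

    base∈block : ∀ e q → f (ι q) ∈ ⁅ f (proj₁ (image G v ext e)) ⁆ ∪ ⁅ f (proj₂ (image G v ext e)) ⁆ →
                 vertex (punchIn v q) ∈ block e
    base∈block e q q∈ =
      subst (_∈ block e) (sym (insertAt-punchIn base v zero q)) (↑ʳ∈⊤++p t q∈)

    ends∈block : ∀ e → vertex (proj₁ (ends G v e)) ∈ block e × vertex (proj₂ (ends G v e)) ∈ block e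
    ends∈block e@(old x y _) = base∈block e x (x∈⁅x⁆∪⁅y⁆ _ _) , base∈block e y (y∈⁅x⁆∪⁅y⁆ _ _)
    -- The block was built from `end q _`, but `v` lies in it through the core.
    ends∈block e@(added q _) = v∈block e , base∈block e q (x∈⁅x⁆∪⁅y⁆ _ _)

    code : ∀ x y → Adj G x y → Edge G v
    code x y p = proj₁ (classify G v x y p)

    ends-code : ∀ x y p → ends G v (code x y p) ≐ (x , y)
    ends-code x y p = proj₂ (classify G v x y p)

    ≐-ends∈ : ∀ {x y x′ y′} {e : Subset (t + N)} → (x , y) ≐ (x′ , y′) →
              vertex x ∈ e × vertex y ∈ e → vertex x′ ∈ e × vertex y′ ∈ e
    ≐-ends∈ (inj₁ (refl , refl)) x,y∈e       = x,y∈e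
    ≐-ends∈ (inj₂ (refl , refl)) (x∈e , y∈e) = y∈e , x∈e

  extension⇒berge : Berge G (colourClass c i)
  extension⇒berge = record
    { φ           = vertex
    ; φ-injective = insertAt-injective v
                      (λ eq → ι-injective (f-injective (↑ʳ-injective t _ _ eq)))
                      -- `t ↑ʳ_` with `t = suc s` yields successors, never `zero`.
                      (λ _ ())
    ; φ∈V         = λ _ → ∈⊤
    ; hyperedge   = λ x y p → block (code x y p)
    ; hyperedge∈H = λ x y p →
        -- The induced colour of an edge of the copy is by definition the colour of its block.
        let a≢b , eq = mono _ _ (image-adj G v ext (code x y p))
        in fromWitness (∣core∪∣ t a≢b , eq)
    ; ends∈       = λ x y p → ≐-ends∈ (ends-code x y p) (ends∈block (code x y p))
    ; hyperedge-≐ = λ x y x′ y′ p p′ → mk⇔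
        -- Equal blocks give equal pairs outside the core, hence the same edge of `F`, hence the
        -- same edge of `G`.
        (λ eq → ≐-trans (≐-sym (ends-code x y p))
                  (≐-trans (image-≐⇒ends-≐ G v ext (code x y p) (code x′ y′ p′)
                              (≐-injective f-injective (core∪-injective t eq)))
                           (ends-code x′ y′ p′)))
        (λ eq → block-≐ {code x y p} {code x′ y′ p′}
                  (ends-≐⇒image-≐ G v ext (code x y p) (code x′ y′ p′)
                    (≐-trans (ends-code x y p) (≐-trans eq (≐-sym (ends-code x′ y′ p′))))))
    }

-- The bound on the Ramsey number

ramsey⇒hyperRamsey : ∀ {n} {G : Graph (suc n)} {v s k N} → RamseyProperty (𝒢* G v) k N →
                     HyperRamseyProperty (3 + s) (𝓑 G) k (suc s + N)
ramsey⇒hyperRamsey ramsey c =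
  let i , _ , _ , ext , copy = ramsey (inducedColouring _ c)
  in i , colourClass c i , extension⇒berge ext c copy , colourClass-mono c i

theorem2 : ∀ {n} (G : Graph (suc n)) (v : Fin (suc n)) (k r : ℕ) → 2 ≤ k → 3 ≤ r →
    ∀ N → IsRamseyNumber (𝒢* G v) k N →
    ∃[ M ] (IsHyperRamseyNumber r (𝓑 G) k M × M ≤ N + r ∸ 2)
theorem2 G v k r@(suc (suc (suc s))) _ (s≤s (s≤s (s≤s _))) N (ramsey , _) =
  least (hyperRamsey? G r k) (N + r ∸ 2)
    -- With `r = 3 + s`, the term `r + N ∸ 2` computes to `suc s + N`, the core together with the
    -- `N` coloured vertices.
    (subst (HyperRamseyProperty r (𝓑 G) k) (cong (_∸ 2) (+-comm r N)) (ramsey⇒hyperRamsey ramsey))
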